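{- For every $n\in\mathbb{N}$, $n\ge 1$, the Boolean network $f^{[n]}$ (defined recursively in the context) is a Hamiltonian cycle Boolean network and is self-dual in $[n]$.
   Context: A Boolean network with $n$ variables is a map $f=(f_1,\dots,f_n):\{0,1\}^n\to\{0,1\}^n$; write $[n]=\{1,\dots,n\}$. Its dynamics is the digraph $\Gamma(f)$ with vertex set $\{0,1\}^n$ and arcs $(x,f(x))$. $f$ is a Hamiltonian cycle network if $\Gamma(f)$ is a single cycle of length $2^n$. For a configuration $x$, $\overline{x}$ denotes the componentwise negation; $f$ is self-dual in $[n]$ if $f(x)=\overline{f(\overline{x})}$ for all $x\in\{0,1\}^n$. Write $x_{[m]}=(x_1,\dots,x_m)$, and let $\vec 0$ be the all-zeros configuration. Recursive construction: $f^{[1]}(x_1)=\overline{x_1}$. Given $f^{[n]}:\{0,1\}^n\to\{0,1\}^n$ ($n\ge1$), let $z=z^{[n+1]}\in\{0,1\}^{n+1}$ be the configuration with $z_{n+1}=0$ and $f^{[n]}(z_{[n]})=\vec 0$ (it exists and is unique because each $f^{[n]}$ is a bijection). Put $h^{[n+1]}(x)=(f^{[n]}(x_{[n]}),x_{n+1})$ for $x\in\{0,1\}^{n+1}$, and $$f^{[n+1]}_i(x)=\bigl(h^{[n+1]}_i(x)\land d_{\overline z}(x)\bigr)\lor c_z(x),\qquad i\in[n+1],$$ where $c_z,d_{\overline z}:\{0,1\}^{n+1}\to\{0,1\}$ are given by $c_z(x)=1$ if and only if $x=z$, and $d_{\overline z}(x)=0$ if and only if $x=\overline z$. -}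

module Defs where

open import Data.Bool.Base using (Bool; true; false; not; _∧_; _∨_)
import Data.Bool.Properties as Bool
open import Data.Empty using (⊥-elim)
open import Data.Fin.Base using (Fin; toℕ)
open import Data.Fin.Subset.Properties using (anySubset?)
open import Data.Nat.Base using (ℕ; zero; suc; _^_; _%_; NonZero)
open import Data.Nat.Properties using (m^n≢0)
open import Data.Product.Base using (∃; _,_)
open import Data.Vec.Base
  using (Vec; []; _∷_; _∷ʳ_; init; last; lookup; map; replicate; tabulate)
open import Data.Vec.Properties using (≡-dec)
open import Level using (0ℓ)
open import Relation.Binary.Core using (Rel)
open import Relation.Binary.Definitions using (DecidableEquality)
open import Relation.Binary.Morphism.Structures using (IsOrderIsomorphism)
open import Relation.Binary.PropositionalEquality.Core using (_≡_)
open import Relation.Nullary.Decidable.Core using (Dec; yes; no; does)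

Config : ℕ → Set
Config n = Vec Bool n

Network : ℕ → Set
Network n = Config n → Config n

infix 4 _≟_

_≟_ : ∀ {n} → DecidableEquality (Config n)
_≟_ = ≡-dec Bool._≟_

0⃗ : ∀ {n} → Config n
0⃗ = replicate _ false

negate : ∀ {n} → Config n → Config n
negate = map not

Γ : ∀ {n} → Network n → Rel (Config n) 0ℓ
Γ f x y = y ≡ f x

CycleArc : ∀ ℓ .{{_ : NonZero ℓ}} → Rel (Fin ℓ) 0ℓ
CycleArc ℓ i j = toℕ j ≡ suc (toℕ i) % ℓ

-- `IsOrderIsomorphism` assumes nothing about the two relations.  With `_≡_` as
-- the equalities it says that v is a bijection on vertices preserving and
-- reflecting arcs, i.e. an isomorphism of digraphs.
IsCycleOfLength : ∀ ℓ .{{_ : NonZero ℓ}} {V : Set} → Rel V 0ℓ → Set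
IsCycleOfLength ℓ {V} _⟶_ =
  ∃ λ (v : Fin ℓ → V) → IsOrderIsomorphism _≡_ _≡_ (CycleArc ℓ) _⟶_ v

IsHamiltonianCycle : ∀ {n} → Network n → Set
IsHamiltonianCycle {n} f = IsCycleOfLength (2 ^ n) {{m^n≢0 2 n}} (Γ f)

IsSelfDual : ∀ {n} → Network n → Set
IsSelfDual f = ∀ x → f x ≡ negate (f (negate x))

-- `anySubset?` searches all of `Vec Bool n`, since `Subset n` is that type.
zeroPreimage? : ∀ {n} (f : Network n) → Dec (∃ λ x → f x ≡ 0⃗)
zeroPreimage? f = anySubset? (λ x → f x ≟ 0⃗)

-- The value 0⃗ in the second case is a placeholder for networks that miss 0⃗.
-- It plays no role for bijective f, where the result is the unique preimage.
zeroPreimage : ∀ {n} → Network n → Config n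
zeroPreimage f with zeroPreimage? f
... | yes (x , _) = x
... | no _        = 0⃗

zeroPreimage-correct : ∀ {n} (f : Network n) →
                       (∃ λ x → f x ≡ 0⃗) → f (zeroPreimage f) ≡ 0⃗
zeroPreimage-correct f ∃x with zeroPreimage? f
... | yes (_ , fx≡0) = fx≡0
... | no ∄x          = ⊥-elim (∄x ∃x)

c : ∀ {n} → Config n → Config n → Bool
c z x = does (x ≟ z)

d : ∀ {n} → Config n → Config n → Bool
d w x = not (does (x ≟ w))

-- Coordinate n+1 is the last entry of the vector, so x_[n] is `init x`.
module Step {n : ℕ} (f : Network n) where

  z : Config (suc n)
  z = zeroPreimage f ∷ʳ false

  h : Network (suc n)
  h x = f (init x) ∷ʳ last x

  next : Network (suc n)
  next x = tabulate λ i → (lookup (h x) i ∧ d (negate z) x) ∨ c z x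

f^[_] : ∀ n .{{_ : NonZero n}} → Network n
f^[ suc zero    ] (x ∷ []) = not x ∷ []
f^[ suc (suc n) ]          = Step.next f^[ suc n ]

{-# OPTIONS --safe #-}
-- The network h runs two copies of the cycle of f, one for each value of the last
-- coordinate, and f^[n+1] differs from h only in that the images of z and of its
-- negation z̄ are exchanged.  Since h maps z to 0⃗ on the first copy and, by
-- self-duality, z̄ to the negation of 0⃗ on the second, this splices the two cycles:
-- from 0⃗ the orbit runs through the first copy up to z, and then through the
-- negation of the same path back to 0⃗.
module Submission where

open import Defs
open import Data.Bool.Base using (true; false; not; _∧_; _∨_)
open import Data.Bool.Properties
  using (not-involutive; not-¬; ∧-identityʳ; ∧-zeroʳ; ∨-identityʳ; ∨-zeroʳ)
open import Data.Fin.Base using (Fin; toℕ; fromℕ<)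
open import Data.Fin.Properties using (toℕ<n; toℕ-fromℕ<; toℕ-injective)
open import Data.Nat.Base using (ℕ; zero; suc; _+_; _∸_; _^_; _%_; _<_; NonZero; z<s; s<s)
open import Data.Nat.DivMod using (m%n<n; m<n⇒m%n≡m; n%n≡0)
open import Data.Nat.GeneralisedArithmetic using (fold; fold-+)
open import Data.Nat.Properties
  using (m^n≢0; n<1+n; <-trans; <-≤-trans; <-≤-connex; m≤m+n; m∸n+n≡m; +-identityʳ;
         +-cancelʳ-<; +-monoˡ-<; m<1+n⇒m<n∨m≡n)
open import Data.Product.Base using (_×_; ∃; _,_; proj₁; proj₂)
open import Data.Sum.Base using (_⊎_; inj₁; inj₂)
open import Data.Vec.Base
  using (Vec; []; _∷_; _∷ʳ_; head; initLast; lookup; map; replicate; tabulate)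
open import Data.Vec.Properties
  using (init-∷ʳ; last-∷ʳ; lookup-map; lookup-replicate; map-∷ʳ; map-∘; map-cong; map-id;
         tabulate-cong; tabulate∘lookup; ∷ʳ-injectiveˡ; ∷ʳ-injectiveʳ)
open import Function.Base using (_∘_; id)
open import Function.Consequences.Propositional using (strictlySurjective⇒surjective)
open import Relation.Binary.PropositionalEquality
  using (_≡_; _≢_; refl; sym; trans; cong; cong₂; subst; module ≡-Reasoning)
open import Relation.Nullary.Decidable using (yes; no; dec-true; dec-false)
open import Relation.Nullary.Negation using (contradiction)

open ≡-Reasoning

module _ {a} {A : Set a} where

  tabulate-lookup : ∀ {n} {g : Fin n → A} (xs : Vec A n) →
                    (∀ i → g i ≡ lookup xs i) → tabulate g ≡ xs
  tabulate-lookup xs g≗xs = trans (tabulate-cong g≗xs) (tabulate∘lookup xs)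

  replicate-∷ʳ : ∀ n (x : A) → replicate (suc n) x ≡ replicate n x ∷ʳ x
  replicate-∷ʳ zero    x = refl
  replicate-∷ʳ (suc n) x = cong (x ∷_) (replicate-∷ʳ n x)

<-double : ∀ {ℓ i} → i < ℓ + ℓ → i < ℓ ⊎ ∃ λ k → k < ℓ × i ≡ k + ℓ
<-double {ℓ} {i} i<2ℓ with <-≤-connex i ℓ
... | inj₁ i<ℓ = inj₁ i<ℓ
... | inj₂ ℓ≤i = inj₂ (i ∸ ℓ , +-cancelʳ-< ℓ (i ∸ ℓ) ℓ (subst (_< ℓ + ℓ) (sym i≡) i<2ℓ) , sym i≡)
  where i≡ = m∸n+n≡m ℓ≤i

negate-involutive : ∀ {n} (x : Config n) → negate (negate x) ≡ x
negate-involutive x = begin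
  negate (negate x)   ≡⟨ map-∘ not not x ⟨
  map (not ∘ not) x   ≡⟨ map-cong not-involutive x ⟩
  map id x            ≡⟨ map-id x ⟩
  x                   ∎

negate-swap : ∀ {n} {x y : Config n} → negate x ≡ y → x ≡ negate y
negate-swap {x = x} x̄≡y = trans (sym (negate-involutive x)) (cong negate x̄≡y)

x≢negate[x] : ∀ {n} (x : Config (suc n)) → x ≢ negate x
x≢negate[x] (b ∷ x) eq = not-¬ refl (cong head eq)

-- Cycles enumerated as the orbit of `0⃗`.

orbit : ∀ {n} → Network n → ℕ → Config n
orbit = fold 0⃗

-- Indices are natural numbers rather than elements of `Fin ℓ`, so that a position can be shifted by
-- `ℓ` when the length doubles. Reduction modulo the length occurs only in `isCycle`.
record IsOrbitCycle {n} (ℓ : ℕ) (f : Network n) : Set where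
  field
    closes   : orbit f ℓ ≡ 0⃗
    distinct : ∀ {i j} → i < ℓ → j < ℓ → orbit f i ≡ orbit f j → i ≡ j
    covers   : ∀ x → ∃ λ i → i < ℓ × orbit f i ≡ x

isCycle : ∀ {n} ℓ .{{_ : NonZero ℓ}} {f : Network n} →
          IsOrbitCycle ℓ f → IsCycleOfLength ℓ (Γ f)
isCycle ℓ {f} cyc = v , record
  { isOrderMonomorphism = record
    { isOrderHomomorphism = record
      { cong = cong v
      ; mono = λ {i} {j} j≡ → trans (cong (orbit f) j≡) (orbit-% (toℕ<n i))
      }
    ; injective = λ {i} {j} eq → toℕ-injective (distinct (toℕ<n i) (toℕ<n j) eq)
    -- The residue is again an index below `ℓ`, so `distinct` also shows that arcs are reflected.
    ; cancel    = λ {i} {j} eq →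
        distinct (toℕ<n j) (m%n<n (suc (toℕ i)) ℓ) (trans eq (sym (orbit-% (toℕ<n i))))
    }
  ; surjective = strictlySurjective⇒surjective λ x →
      let i , i<ℓ , eq = covers x
      in fromℕ< i<ℓ , trans (cong (orbit f) (toℕ-fromℕ< i<ℓ)) eq
  }
  where
  open IsOrbitCycle cyc

  v : Fin ℓ → Config _
  v i = orbit f (toℕ i)

  orbit-% : ∀ {k} → k < ℓ → orbit f (suc k % ℓ) ≡ orbit f (suc k)
  orbit-% {k} k<ℓ with m<1+n⇒m<n∨m≡n (s<s k<ℓ)
  ... | inj₁ 1+k<ℓ = cong (orbit f) (m<n⇒m%n≡m 1+k<ℓ)
  -- Only the last index wraps around; there `closes` supplies the arc back to `0⃗`.
  ... | inj₂ refl  = trans (cong (orbit f) (n%n≡0 (suc k))) (sym closes)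

selfDual-negate : ∀ {n} {f : Network n} → IsSelfDual f → ∀ x → f (negate x) ≡ negate (f x)
selfDual-negate {f = f} dual x =
  trans (dual (negate x)) (cong (negate ∘ f) (negate-involutive x))

-- Self-duality says that `f` commutes with negation, hence so do its iterates: antipodal starting
-- points stay antipodal.
fold-negate : ∀ {n} {f : Network n} → IsSelfDual f →
              ∀ x k → fold (negate x) f k ≡ negate (fold x f k)
fold-negate         dual x zero    = refl
fold-negate {f = f} dual x (suc k) =
  trans (cong f (fold-negate dual x k)) (selfDual-negate dual (fold x f k))

-- Values and self-duality of the recursion step.

module _ {n} {f : Network n} where

  open Step f

  next-z : next z ≡ negate 0⃗
  next-z = tabulate-lookup (negate 0⃗) λ i → begin
    (lookup (h z) i ∧ d (negate z) z) ∨ c z z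
      ≡⟨ cong ((lookup (h z) i ∧ d (negate z) z) ∨_) (dec-true (z ≟ z) refl) ⟩
    (lookup (h z) i ∧ d (negate z) z) ∨ true
      ≡⟨ ∨-zeroʳ _ ⟩
    true
      ≡⟨ cong not (lookup-replicate i false) ⟨
    not (lookup 0⃗ i)
      ≡⟨ lookup-map i not 0⃗ ⟨
    lookup (negate 0⃗) i ∎

  next-negate[z] : next (negate z) ≡ 0⃗
  next-negate[z] = tabulate-lookup 0⃗ λ i → begin
    (lookup (h z̄) i ∧ d z̄ z̄) ∨ c z z̄
      ≡⟨ cong₂ (λ p q → (lookup (h z̄) i ∧ not p) ∨ q)
               -- The disjunct `c z` vanishes because `z` has at least one coordinate and so differs
               -- from its negation.
               (dec-true (z̄ ≟ z̄) refl) (dec-false (z̄ ≟ z) (x≢negate[x] z ∘ sym)) ⟩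
    (lookup (h z̄) i ∧ false) ∨ false
      ≡⟨ ∨-identityʳ _ ⟩
    lookup (h z̄) i ∧ false
      ≡⟨ ∧-zeroʳ _ ⟩
    false
      ≡⟨ lookup-replicate i false ⟨
    lookup 0⃗ i ∎
    where z̄ = negate z

  next≡h : ∀ {x} → x ≢ z → x ≢ negate z → next x ≡ h x
  next≡h {x} x≢z x≢z̄ = tabulate-lookup (h x) λ i → begin
    (lookup (h x) i ∧ d (negate z) x) ∨ c z x
      ≡⟨ cong₂ (λ p q → (lookup (h x) i ∧ not p) ∨ q)
               (dec-false (x ≟ negate z) x≢z̄) (dec-false (x ≟ z) x≢z) ⟩
    (lookup (h x) i ∧ true) ∨ false
      ≡⟨ ∨-identityʳ _ ⟩
    lookup (h x) i ∧ true
      ≡⟨ ∧-identityʳ _ ⟩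
    lookup (h x) i ∎

  h-∷ʳ : ∀ y b → h (y ∷ʳ b) ≡ f y ∷ʳ b
  h-∷ʳ y b = cong₂ (λ y b → f y ∷ʳ b) (init-∷ʳ b y) (last-∷ʳ b y)

  h-selfDual : IsSelfDual f → IsSelfDual h
  h-selfDual dual x with initLast x
  ... | y , b , refl = begin
    f y ∷ʳ b                          ≡⟨ cong₂ _∷ʳ_ (dual y) (sym (not-involutive b)) ⟩
    negate (f (negate y)) ∷ʳ not (not b) ≡⟨ map-∷ʳ not (not b) (f (negate y)) ⟨
    negate (f (negate y) ∷ʳ not b)    ≡⟨ cong negate (h-∷ʳ (negate y) (not b)) ⟨
    negate (h (negate y ∷ʳ not b))    ≡⟨ cong (negate ∘ h) (map-∷ʳ not b y) ⟨
    negate (h (negate (y ∷ʳ b)))      ∎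

  position : ∀ x → x ≡ z ⊎ x ≡ negate z ⊎ (x ≢ z × x ≢ negate z)
  position x with x ≟ z | x ≟ negate z
  ... | yes x≡z | _       = inj₁ x≡z
  ... | no _    | yes x≡z̄ = inj₂ (inj₁ x≡z̄)
  ... | no x≢z  | no x≢z̄  = inj₂ (inj₂ (x≢z , x≢z̄))

  -- Negation exchanges `z` with `negate z` and also their images, `negate 0⃗` and `0⃗`. The
  -- remaining configurations are closed under negation, and there `next` agrees with the self-dual
  -- `h`.
  next-selfDual : IsSelfDual f → IsSelfDual next
  next-selfDual dual x with position x
  ... | inj₁ refl = trans next-z (sym (cong negate next-negate[z]))
  ... | inj₂ (inj₁ refl) = begin
    next (negate z)                   ≡⟨ next-negate[z] ⟩
    0⃗                                 ≡⟨ negate-involutive 0⃗ ⟨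
    negate (negate 0⃗)                 ≡⟨ cong negate next-z ⟨
    negate (next z)                   ≡⟨ cong (negate ∘ next) (negate-involutive z) ⟨
    negate (next (negate (negate z))) ∎
  ... | inj₂ (inj₂ (x≢z , x≢z̄)) = begin
    next x                   ≡⟨ next≡h x≢z x≢z̄ ⟩
    h x                      ≡⟨ h-selfDual dual x ⟩
    negate (h (negate x))    ≡⟨ cong negate (next≡h (x≢z̄ ∘ negate-swap) x̄≢z̄) ⟨
    negate (next (negate x)) ∎
    where
    x̄≢z̄ : negate x ≢ negate z
    x̄≢z̄ eq = x≢z (trans (negate-swap eq) (negate-involutive z))

  -- Among configurations ending in `false` the only exceptional one is `z`, since `negate z` ends
  -- in `true`.
  next-∷ʳ-false : ∀ {y} → y ≢ zeroPreimage f → next (y ∷ʳ false) ≡ f y ∷ʳ false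
  next-∷ʳ-false {y} y≢ = trans (next≡h y0≢z y0≢z̄) (h-∷ʳ y false)
    where
    y0≢z : y ∷ʳ false ≢ z
    y0≢z = y≢ ∘ ∷ʳ-injectiveˡ y _

    y0≢z̄ : y ∷ʳ false ≢ negate z
    y0≢z̄ eq with () ← ∷ʳ-injectiveʳ y _ (trans eq (map-∷ʳ not false (zeroPreimage f)))

  -- Splicing the two copies of the cycle.

  module _ {m} (dual : IsSelfDual f) (cyc : IsOrbitCycle (suc m) f) where

    open IsOrbitCycle cyc

    private
      ℓ = suc m

    f[zeroPreimage]≡0⃗ : f (zeroPreimage f) ≡ 0⃗
    -- By `closes`, the last point of the orbit is a preimage of `0⃗`, so the search does not fall
    -- back on its default.
    f[zeroPreimage]≡0⃗ = zeroPreimage-correct f (orbit f m , closes)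

    -- Otherwise the orbit would be back at `0⃗` at index `suc k`, before completing the cycle.
    orbit≢zeroPreimage : ∀ {k} → suc k < ℓ → orbit f k ≢ zeroPreimage f
    orbit≢zeroPreimage 1+k<ℓ eq
      with () ← distinct 1+k<ℓ z<s (trans (cong f eq) f[zeroPreimage]≡0⃗)

    orbit-last : orbit f m ≡ zeroPreimage f
    orbit-last with covers (zeroPreimage f)
    ... | i , i<ℓ , eq with m<1+n⇒m<n∨m≡n i<ℓ
    ...   | inj₁ i<m  = contradiction eq (orbit≢zeroPreimage (s<s i<m))
    ...   | inj₂ refl = eq

    -- The first `m` steps never start at `z`, which is reached only at index `m`; so they follow
    -- `f` and keep the last coordinate.
    orbit-lower : ∀ {k} → k < ℓ → orbit next k ≡ orbit f k ∷ʳ false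
    orbit-lower {zero}  _     = replicate-∷ʳ n false
    orbit-lower {suc k} 1+k<ℓ =
      trans (cong next (orbit-lower (<-trans (n<1+n k) 1+k<ℓ)))
            (next-∷ʳ-false (orbit≢zeroPreimage 1+k<ℓ))

    orbit-half : orbit next ℓ ≡ negate 0⃗
    orbit-half = begin
      next (orbit next m)       ≡⟨ cong next (orbit-lower (n<1+n m)) ⟩
      next (orbit f m ∷ʳ false) ≡⟨ cong (next ∘ (_∷ʳ false)) orbit-last ⟩
      next z                    ≡⟨ next-z ⟩
      negate 0⃗                  ∎

    -- After `ℓ` steps the orbit stands at the antipode of its start, and self-duality of `next`
    -- makes everything after that the negation of what came before.
    orbit-antipodal : ∀ k → orbit next (k + ℓ) ≡ negate (orbit next k)
    orbit-antipodal k = begin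
      orbit next (k + ℓ)           ≡⟨ fold-+ 0⃗ next k ⟩
      fold (orbit next ℓ) next k   ≡⟨ cong (λ x → fold x next k) orbit-half ⟩
      fold (negate 0⃗) next k       ≡⟨ fold-negate (next-selfDual dual) 0⃗ k ⟩
      negate (orbit next k)        ∎

    orbit-upper : ∀ {k} → k < ℓ → orbit next (k + ℓ) ≡ negate (orbit f k) ∷ʳ true
    orbit-upper {k} k<ℓ = begin
      orbit next (k + ℓ)         ≡⟨ orbit-antipodal k ⟩
      negate (orbit next k)      ≡⟨ cong negate (orbit-lower k<ℓ) ⟩
      negate (orbit f k ∷ʳ false) ≡⟨ map-∷ʳ not false (orbit f k) ⟩
      negate (orbit f k) ∷ʳ true ∎

    lower≢upper : ∀ {i k} → i < ℓ → k < ℓ → orbit next i ≢ orbit next (k + ℓ)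
    lower≢upper i<ℓ k<ℓ eq
      with () ← ∷ʳ-injectiveʳ _ _ (trans (sym (orbit-lower i<ℓ)) (trans eq (orbit-upper k<ℓ)))

    next-distinct-lower : ∀ {i j} → i < ℓ → j < ℓ → orbit next i ≡ orbit next j → i ≡ j
    next-distinct-lower i<ℓ j<ℓ eq = distinct i<ℓ j<ℓ
      (∷ʳ-injectiveˡ _ _ (trans (sym (orbit-lower i<ℓ)) (trans eq (orbit-lower j<ℓ))))

    next-distinct : ∀ {i j} → i < ℓ + ℓ → j < ℓ + ℓ → orbit next i ≡ orbit next j → i ≡ j
    next-distinct i<2ℓ j<2ℓ eq with <-double i<2ℓ | <-double j<2ℓ
    ... | inj₁ i<ℓ              | inj₁ j<ℓ              = next-distinct-lower i<ℓ j<ℓ eq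
    ... | inj₁ i<ℓ              | inj₂ (k , k<ℓ , refl) = contradiction eq (lower≢upper i<ℓ k<ℓ)
    ... | inj₂ (k , k<ℓ , refl) | inj₁ j<ℓ              = contradiction (sym eq) (lower≢upper j<ℓ k<ℓ)
    ... | inj₂ (k , k<ℓ , refl) | inj₂ (l , l<ℓ , refl) =
      -- Negating both points moves them back to the first half, where distinctness is inherited
      -- from `f`.
      cong (_+ ℓ) (next-distinct-lower k<ℓ l<ℓ (begin
        orbit next k                   ≡⟨ negate-swap (sym (orbit-antipodal k)) ⟩
        negate (orbit next (k + ℓ))    ≡⟨ cong negate eq ⟩
        negate (orbit next (l + ℓ))    ≡⟨ negate-swap (sym (orbit-antipodal l)) ⟨
        orbit next l                   ∎))

    next-covers : ∀ x → ∃ λ i → i < ℓ + ℓ × orbit next i ≡ x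
    next-covers x with initLast x
    ... | y , false , refl with covers y
    ...   | i , i<ℓ , eq =
      i , <-≤-trans i<ℓ (m≤m+n ℓ ℓ) , trans (orbit-lower i<ℓ) (cong (_∷ʳ false) eq)
    -- The second half traverses the cycle of `f` negated, so the index to use is that of
    -- `negate y`, shifted by `ℓ`.
    next-covers x | y , true , refl with covers (negate y)
    ...   | i , i<ℓ , eq =
      i + ℓ , +-monoˡ-< ℓ i<ℓ ,
      trans (orbit-upper i<ℓ) (cong (_∷ʳ true) (trans (cong negate eq) (negate-involutive y)))

    next-isOrbitCycle : IsOrbitCycle (ℓ + ℓ) next
    next-isOrbitCycle = record
      { closes   = begin
          orbit next (ℓ + ℓ)     ≡⟨ orbit-antipodal ℓ ⟩
          negate (orbit next ℓ)  ≡⟨ cong negate orbit-half ⟩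
          negate (negate 0⃗)      ≡⟨ negate-involutive 0⃗ ⟩
          0⃗                      ∎
      ; distinct = next-distinct
      ; covers   = next-covers
      }

-- The case split exposes the last index `m`, which a length of the form `2 ^ suc n` does not show.
-- Length zero is impossible, because `covers` would yield an index below it.
isOrbitCycle-double : ∀ {n} {f : Network n} ℓ → IsSelfDual f →
                      IsOrbitCycle ℓ f → IsOrbitCycle (ℓ + ℓ) (Step.next f)
isOrbitCycle-double zero dual cyc with () ← proj₁ (proj₂ (IsOrbitCycle.covers cyc 0⃗))
isOrbitCycle-double (suc m) dual cyc = next-isOrbitCycle dual cyc

f-selfDual : ∀ n → IsSelfDual f^[ suc n ]
f-selfDual zero    (b ∷ []) = cong (λ b → not b ∷ []) (sym (not-involutive b))
f-selfDual (suc n) = next-selfDual (f-selfDual n)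

f-isOrbitCycle : ∀ n → IsOrbitCycle (2 ^ suc n) f^[ suc n ]
f-isOrbitCycle zero = record
  { closes   = refl
  ; distinct = distinct₁
  ; covers   = λ where
      (false ∷ []) → 0 , z<s , refl
      (true  ∷ []) → 1 , s<s z<s , refl
  }
  where
  distinct₁ : ∀ {i j} → i < 2 → j < 2 → orbit f^[ 1 ] i ≡ orbit f^[ 1 ] j → i ≡ j
  distinct₁ {0} {0} _ _ _ = refl
  distinct₁ {1} {1} _ _ _ = refl
  distinct₁ {0} {1} _ _ ()
  distinct₁ {1} {0} _ _ ()
  distinct₁ {suc (suc _)} (s<s (s<s ())) _ _
  distinct₁ {_} {suc (suc _)} _ (s<s (s<s ())) _
f-isOrbitCycle (suc n) =
  subst (λ ℓ → IsOrbitCycle ℓ f^[ suc (suc n) ])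
        -- The power `2 ^ suc (suc n)` unfolds to `2 ^ suc n + (2 ^ suc n + 0)`.
        (cong (2 ^ suc n +_) (sym (+-identityʳ (2 ^ suc n))))
        (isOrbitCycle-double (2 ^ suc n) (f-selfDual n) (f-isOrbitCycle n))

lemma4p6 : ∀ (n : ℕ) .{{_ : NonZero n}} → IsHamiltonianCycle f^[ n ] × IsSelfDual f^[ n ]
lemma4p6 (suc n) = isCycle (2 ^ suc n) {{m^n≢0 2 (suc n)}} (f-isOrbitCycle n) , f-selfDual n
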